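{- Let $m\ge 2$ be an even integer and let $V=\{2s_1,\dots,2s_{\ell}\}$ with $\ell\ge 1$ and integers $1\le s_1<\cdots<s_{\ell}\le \frac{m}{2}$. Put $t_j=s_{j+1}-s_j$ for $1\le j\le \ell-1$ and $t_{\ell}=\frac{m}{2}-s_{\ell}+s_1$. For a positive integer $j$ let $\overline{j}\in\{1,\dots,\ell\}$ denote the element with $\overline{j}\equiv j\pmod{\ell}$. Then the sequence $H(D^{(m,V)})$ of Hankel determinants can be partitioned into consecutive sections of the form \[ H(D^{(m,V)})=(\underbrace{1,\dots,1}_{s_1},\underbrace{a_{1,1},\dots,a_{1,t_1}}_{t_1},\dots,\underbrace{a_{\ell,1},\dots,a_{\ell,t_{\ell}}}_{t_{\ell}},\underbrace{a_{\ell+1,1},\dots,a_{\ell+1,t_1}}_{t_1},\dots,\underbrace{a_{2\ell,1},\dots,a_{2\ell,t_{\ell}}}_{t_{\ell}},\dots) \] (the $j$-th section, $j\ge 1$, having length $t_{\overline{j}}$), such that each section $(a_{j,1},\dots,a_{j,t_{\overline{j}}})$ is an arithmetic progression with common difference $d_j$, where $a_{1,1}=0$, $d_1=-1$, and for $j\ge 2$: $a_{j,1}=d_{j-1}$ and $d_j=d_{j-1}-a_{j-1,t_{\overline{j-1}}}$.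
   Context: For an integer $m\ge 2$ and $V\subseteq[m]=\{1,\dots,m\}$, let $(m,V)=\{k\in\mathbb{Z}^+ : k\equiv j \pmod m \text{ for some } j\in V\}$. A Dyck path of size $n$ is a lattice path from $(0,0)$ to $(2n,0)$ with steps $(1,1)$ and $(1,-1)$ never going below the $x$-axis; a peak is an up-step immediately followed by a down-step, and its height is the $y$-coordinate of the point between them. Let $d_n^{(m,V)}$ be the number of Dyck paths of size $n$ none of whose peaks has height in $(m,V)$ (so $d_0^{(m,V)}=1$), and $D^{(m,V)}(x)=\sum_{n\ge0}d_n^{(m,V)}x^n$. For a power series $F=\sum_{n\ge0}f_nx^n$, $n\ge1$ and $k\ge0$, $H^{(k)}_n(F)=\det(f_{k+i+j})_{0\le i,j\le n-1}$, $H_n(F)=H^{(0)}_n(F)$, and $H(F)=(H_1(F),H_2(F),H_3(F),\dots)$. -}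

module Defs where

open import Data.Bool using (Bool; true; false; _∧_; not; if_then_else_)
open import Data.Nat using (ℕ; zero; suc; _+_; _*_; _∸_; _≡ᵇ_; _≤ᵇ_; _<ᵇ_; NonZero; _/_; _%_)
open import Data.Nat.DivMod using (_mod_)
open import Data.Fin using (Fin; zero; suc; toℕ; punchIn)
open import Data.List using (List; []; _∷_; map; _++_)
open import Data.Bool.ListAction using (any)
open import Data.Integer using (ℤ; +_; -_; _-_) renaming (_+_ to _+ℤ_; _*_ to _*ℤ_; _^_ to _^ℤ_)

-- Dyck paths as words of steps (true = up step (1,1), false = down (1,-1))

words : ℕ → List (List Bool)
words zero    = [] ∷ []
words (suc k) = map (true ∷_) (words k) ++ map (false ∷_) (words k)

isDyckFrom : ℕ → List Bool → Bool
isDyckFrom h []               = h ≡ᵇ 0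
isDyckFrom h (true ∷ xs)      = isDyckFrom (suc h) xs
isDyckFrom zero (false ∷ xs)  = false
isDyckFrom (suc h) (false ∷ xs) = isDyckFrom h xs

noPeakIn : (ℕ → Bool) → ℕ → List Bool → Bool
noPeakIn P h []                  = true
noPeakIn P h (true ∷ false ∷ xs) = not (P (suc h)) ∧ noPeakIn P (suc h) (false ∷ xs)
noPeakIn P h (true ∷ xs)         = noPeakIn P (suc h) xs
noPeakIn P h (false ∷ xs)        = noPeakIn P (h ∸ 1) xs

inMV : (m : ℕ) → .{{NonZero m}} → List ℕ → ℕ → Bool
inMV m V k = (1 ≤ᵇ k) ∧ any (λ j → (k % m) ≡ᵇ (j % m)) V

countTrue : {A : Set} → (A → Bool) → List A → ℕ
countTrue f []       = 0
countTrue f (x ∷ xs) = if f x then suc (countTrue f xs) else countTrue f xs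

dMV : (m : ℕ) → .{{NonZero m}} → List ℕ → ℕ → ℕ
dMV m V n = countTrue (λ w → isDyckFrom 0 w ∧ noPeakIn (inMV m V) 0 w) (words (2 * n))

sumFin : (n : ℕ) → (Fin n → ℤ) → ℤ
sumFin zero    f = + 0
sumFin (suc n) f = f zero +ℤ sumFin n (λ i → f (suc i))

det : (n : ℕ) → (Fin n → Fin n → ℤ) → ℤ
det zero    M = + 1
det (suc n) M = sumFin (suc n) (λ j →
  (((- (+ 1)) ^ℤ toℕ j) *ℤ M zero j) *ℤ det n (λ a b → M (suc a) (punchIn j b)))

hankel : (ℕ → ℤ) → ℕ → ℤ
hankel f n = det n (λ i j → f (toℕ i + toℕ j))

hankelD : (m : ℕ) → .{{NonZero m}} → List ℕ → ℕ → ℤ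
hankelD m V n = hankel (λ k → + dMV m V k) n

-- Data of the theorem.  ℓ = suc k; s : Fin ℓ → ℕ with index i ↔ s_{i+1}.

Vof : (k : ℕ) → (Fin (suc k) → ℕ) → List ℕ
Vof k s = Data.List.map (λ i → 2 * s i) (Data.List.allFin (suc k))
  where import Data.List

-- s at a natural-number index (0-based); only used for indices ≤ k
sAt : (k : ℕ) → (Fin (suc k) → ℕ) → ℕ → ℕ
sAt k       s zero    = s zero
sAt zero    s (suc n) = 0
sAt (suc k) s (suc n) = sAt k (λ x → s (suc x)) n

tlen : (m k : ℕ) → (Fin (suc k) → ℕ) → Fin (suc k) → ℕ
tlen m k s i =
  if suc (toℕ i) ≤ᵇ k
  then sAt k s (suc (toℕ i)) ∸ s i
  else m / 2 ∸ s i + s zero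

-- length of the (j+1)-th section: t_{\overline{j+1}}
secLen : (m k : ℕ) → (Fin (suc k) → ℕ) → ℕ → ℕ
secLen m k s j = tlen m k s (j mod suc k)

secOffset : (m k : ℕ) → (Fin (suc k) → ℕ) → ℕ → ℕ
secOffset m k s zero    = 0
secOffset m k s (suc j) = secOffset m k s j + secLen m k s j

-- (a_{j+1,1}, d_{j+1}):  a_{1,1} = 0, d_1 = -1,
-- a_{j,1} = d_{j-1},  d_j = d_{j-1} - a_{j-1, t_{\overline{j-1}}}
-- where a_{j-1, t} = a_{j-1,1} + (t-1) d_{j-1} (arithmetic progression)
record AD : Set where
  constructor ad
  field
    first : ℤ
    diff  : ℤ

secAD : (m k : ℕ) → (Fin (suc k) → ℕ) → ℕ → AD
secAD m k s zero    = ad (+ 0) (- (+ 1))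
secAD m k s (suc j) =
  let p = secAD m k s j
      lastTerm = AD.first p +ℤ ((+ (secLen m k s j ∸ 1)) *ℤ AD.diff p)
  in ad (AD.diff p) (AD.diff p - lastTerm)

{-# OPTIONS --safe #-}

-- Cutting a Dyck path of size i + j after 2i steps expresses the Hankel matrix of D as O T Oᵗ.
-- Here O is lower unitriangular (its entries count paths between 0 and odd heights) and T is
-- tridiagonal with off-diagonal entries 1 and diagonal entries T₀₀ = 1 and T_gg = 2 - ε_g, where
-- ε_g = 1 if height 2g is forbidden for peaks and ε_g = 0 otherwise.  Peaks at odd heights are
-- unrestricted because m and the elements of V are even.  So H_n = det T_n, and expanding along
-- the last row gives H_{n+1} = (2 - ε_n) H_n - H_{n-1}.  Between consecutive forbidden heights
-- this recurrence continues an arithmetic progression; at a forbidden height 2n it reads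
-- H_{n+1} = H_n - H_{n-1}, so the next progression starts with the previous common difference.

module Submission where

open import Defs
open import Data.Bool using (Bool; true; false; _∧_; if_then_else_)
import Data.Bool.Properties as Boolₚ
open import Data.Empty using (⊥)
open import Data.Fin using (Fin; zero; suc; toℕ; punchIn) renaming (_<_ to _<ᶠ_)
import Data.Fin.Properties as Finₚ
open import Data.Integer using (ℤ; +_; -_; _-_) renaming (_+_ to _+ℤ_; _*_ to _*ℤ_; _^_ to _^ℤ_)
import Data.Integer.Properties as ℤₚ
open import Data.Integer.Tactic.RingSolver using (solve-∀)
open import Data.List using (List; []; _∷_; map; _++_)
open import Data.List.Membership.Propositional using (lose; find)
open import Data.List.Membership.Propositional.Properties using (∈-allFin)
import Data.List.Relation.Unary.Any.Properties as Anyₚ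
open import Data.Nat using (ℕ; zero; suc; _+_; _*_; _∸_; _≤_; _<_; _≤ᵇ_; _≡ᵇ_; s≤s; z≤n; NonZero;
  _/_; _%_; compare; less; equal; greater)
import Data.Nat.Properties as ℕₚ
open import Data.Nat.DivMod using (_mod_; m≡m%n+[m/n]*n; [m+kn]%n≡m%n; m<n⇒m%n≡m; n%n≡0; m%n<n;
  m*n/n≡m; %-congˡ)
open import Data.Nat.Divisibility using (_∣_; divides)
open import Data.Nat.Tactic.RingSolver using () renaming (solve-∀ to solve-∀ℕ)
open import Data.Product using (_×_; _,_; proj₁; proj₂; ∃; ∃₂)
open import Data.Sum using (_⊎_; inj₁; inj₂)
open import Data.Vec.Functional using () renaming (_∷_ to _∷ᵛ_)
open import Function using (_∘_)
open import Function.Bundles using (Equivalence)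
open import Relation.Binary.PropositionalEquality

-- Determinants

sumFin-cong : ∀ n {f g : Fin n → ℤ} → (∀ i → f i ≡ g i) → sumFin n f ≡ sumFin n g
sumFin-cong zero    eq = refl
sumFin-cong (suc n) eq = cong₂ _+ℤ_ (eq zero) (sumFin-cong n (λ i → eq (suc i)))

sumFin-zero : ∀ n {f : Fin n → ℤ} → (∀ i → f i ≡ + 0) → sumFin n f ≡ + 0
sumFin-zero zero    eq = refl
sumFin-zero (suc n) eq = cong₂ _+ℤ_ (eq zero) (sumFin-zero n (λ i → eq (suc i)))

sumFin-distrib-+ : ∀ n (f g : Fin n → ℤ) → sumFin n (λ i → f i +ℤ g i) ≡ sumFin n f +ℤ sumFin n g
sumFin-distrib-+ zero    f g = refl
sumFin-distrib-+ (suc n) f g =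
  trans (cong (f zero +ℤ g zero +ℤ_) (sumFin-distrib-+ n (λ i → f (suc i)) (λ i → g (suc i))))
        (interchange (f zero) (g zero) (sumFin n (λ i → f (suc i))) (sumFin n (λ i → g (suc i))))
  where
  interchange : ∀ a b c d → (a +ℤ b) +ℤ (c +ℤ d) ≡ (a +ℤ c) +ℤ (b +ℤ d)
  interchange = solve-∀

*-distribˡ-sumFin : ∀ n (c : ℤ) (f : Fin n → ℤ) → c *ℤ sumFin n f ≡ sumFin n (λ i → c *ℤ f i)
*-distribˡ-sumFin zero    c f = ℤₚ.*-zeroʳ c
*-distribˡ-sumFin (suc n) c f =
  trans (ℤₚ.*-distribˡ-+ c (f zero) (sumFin n (λ i → f (suc i))))
        (cong (c *ℤ f zero +ℤ_) (*-distribˡ-sumFin n c (λ i → f (suc i))))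

sumFin-comm : ∀ n m (f : Fin n → Fin m → ℤ) →
  sumFin n (λ i → sumFin m (f i)) ≡ sumFin m (λ j → sumFin n (λ i → f i j))
sumFin-comm zero    m f = sym (sumFin-zero m (λ _ → refl))
sumFin-comm (suc n) m f =
  trans (cong (sumFin m (f zero) +ℤ_) (sumFin-comm n m (λ i → f (suc i))))
        (sym (sumFin-distrib-+ m (f zero) (λ j → sumFin n (λ i → f (suc i) j))))

Matrix : ℕ → Set
Matrix n = Fin n → Fin n → ℤ

sgn : ∀ {n} → Fin n → ℤ
sgn j = (- (+ 1)) ^ℤ toℕ j

minor : ∀ {n} → Matrix (suc n) → Fin (suc n) → Matrix n
minor M j a b = M (suc a) (punchIn j b)

det-expand-cong : ∀ n (M N : Matrix (suc n)) → (∀ j → M zero j ≡ N zero j) →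
  (∀ j → det n (minor M j) ≡ det n (minor N j)) → det (suc n) M ≡ det (suc n) N
det-expand-cong n M N row₀ minors = sumFin-cong (suc n)
  {λ j → (sgn j *ℤ M zero j) *ℤ det n (minor M j)}
  {λ j → (sgn j *ℤ N zero j) *ℤ det n (minor N j)}
  (λ j → cong₂ (λ x d → (sgn j *ℤ x) *ℤ d) (row₀ j) (minors j))

det-cong : ∀ n (M N : Matrix n) → (∀ i j → M i j ≡ N i j) → det n M ≡ det n N
det-cong zero    M N eq = refl
det-cong (suc n) M N eq = det-expand-cong n M N (eq zero)
  (λ j → det-cong n (minor M j) (minor N j) (λ a b → eq (suc a) (punchIn j b)))

minor-column : ∀ {n} → Matrix (suc n) → Fin (suc n) → Matrix n
minor-column M i a b = M (punchIn i a) (suc b)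

-- The corner term is the same in both expansions. In the remaining terms of the row expansion, each
-- minor is expanded along its first column by induction; deleting row 0 and column `suc j`, then
-- row `suc i` and column 0, leaves the same `core i j` in either order, so exchanging the two sums
-- gives the column expansion.
det-expand-column : ∀ n (M : Matrix (suc n)) →
  det (suc n) M ≡ sumFin (suc n) (λ i → (sgn i *ℤ M i zero) *ℤ det n (minor-column M i))
det-expand-column zero    M = refl
det-expand-column (suc n) M = cong (_+ℤ_ ((+ 1 *ℤ M zero zero) *ℤ det (suc n) (minor M zero))) (begin
  sumFin (suc n) (λ j → row j *ℤ det (suc n) (minor M (suc j)))
    ≡⟨ sumFin-cong (suc n) {λ j → row j *ℤ det (suc n) (minor M (suc j))}
                           {λ j → row j *ℤ sumFin (suc n) (λ i → col i *ℤ core i j)}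
         (λ j → cong (row j *ℤ_) (det-expand-column n (minor M (suc j)))) ⟩
  sumFin (suc n) (λ j → row j *ℤ sumFin (suc n) (λ i → col i *ℤ core i j))
    ≡⟨ sumFin-cong (suc n) {λ j → row j *ℤ sumFin (suc n) (λ i → col i *ℤ core i j)}
                           {λ j → sumFin (suc n) (λ i → row j *ℤ (col i *ℤ core i j))}
         (λ j → *-distribˡ-sumFin (suc n) (row j) (λ i → col i *ℤ core i j)) ⟩
  sumFin (suc n) (λ j → sumFin (suc n) (λ i → row j *ℤ (col i *ℤ core i j)))
    ≡⟨ sumFin-comm (suc n) (suc n) (λ j i → row j *ℤ (col i *ℤ core i j)) ⟩
  sumFin (suc n) (λ i → sumFin (suc n) (λ j → row j *ℤ (col i *ℤ core i j)))
    ≡⟨ sumFin-cong (suc n) {λ i → sumFin (suc n) (λ j → row j *ℤ (col i *ℤ core i j))}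
                           {λ i → sumFin (suc n) (λ j → col⁻ i *ℤ (row⁺ j *ℤ core i j))}
         (λ i → sumFin-cong (suc n) {λ j → row j *ℤ (col i *ℤ core i j)}
                                    {λ j → col⁻ i *ℤ (row⁺ j *ℤ core i j)}
            (λ j → exchange (sgn j) (M zero (suc j)) (sgn i) (M (suc i) zero) (core i j))) ⟩
  sumFin (suc n) (λ i → sumFin (suc n) (λ j → col⁻ i *ℤ (row⁺ j *ℤ core i j)))
    ≡⟨ sumFin-cong (suc n) {λ i → sumFin (suc n) (λ j → col⁻ i *ℤ (row⁺ j *ℤ core i j))}
                           {λ i → col⁻ i *ℤ det (suc n) (minor-column M (suc i))}
         (λ i → sym (*-distribˡ-sumFin (suc n) (col⁻ i) (λ j → row⁺ j *ℤ core i j))) ⟩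
  sumFin (suc n) (λ i → col⁻ i *ℤ det (suc n) (minor-column M (suc i))) ∎)
  where
  open ≡-Reasoning
  row row⁺ col col⁻ : Fin (suc n) → ℤ
  row j = sgn (suc j) *ℤ M zero (suc j)
  row⁺ j = sgn j *ℤ M zero (suc j)
  col i = sgn i *ℤ M (suc i) zero
  col⁻ i = sgn (suc i) *ℤ M (suc i) zero
  core : Fin (suc n) → Fin (suc n) → ℤ
  core i j = det n (λ a b → M (suc (punchIn i a)) (suc (punchIn j b)))
  exchange : ∀ s x t y d → ((- (+ 1) *ℤ s) *ℤ x) *ℤ ((t *ℤ y) *ℤ d) ≡ ((- (+ 1) *ℤ t) *ℤ y) *ℤ ((s *ℤ x) *ℤ d)
  exchange = solve-∀

det-transpose : ∀ n (M : Matrix n) → det n (λ i j → M j i) ≡ det n M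
det-transpose zero    M = refl
det-transpose (suc n) M = trans
  (sumFin-cong (suc n) {λ i → (sgn i *ℤ M i zero) *ℤ det n (λ a b → minor-column M i b a)}
                       {λ i → (sgn i *ℤ M i zero) *ℤ det n (minor-column M i)}
    (λ i → cong (sgn i *ℤ M i zero *ℤ_) (det-transpose n (minor-column M i))))
  (sym (det-expand-column n M))

-- In the row expansion the first two terms trade places and signs; every other minor still contains
-- both columns, so induction applies. The relation between `M` and `N` is pointwise so that it
-- passes to minors.
det-swap-columns : ∀ n (M N : Matrix (suc (suc n))) →
  (∀ i → N i zero ≡ M i (suc zero)) → (∀ i → N i (suc zero) ≡ M i zero) →
  (∀ i j → N i (suc (suc j)) ≡ M i (suc (suc j))) →
  det (suc (suc n)) N ≡ - det (suc (suc n)) M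
det-swap-columns n M N e₀ e₁ e₂ = begin
  term N zero +ℤ (term N (suc zero) +ℤ rest N)
    ≡⟨ cong₂ _+ℤ_ (cong₂ (λ x d → (+ 1 *ℤ x) *ℤ d) (e₀ zero) (det-cong (suc n) (minor N zero) (minor M (suc zero)) minor₀))
      (cong₂ _+ℤ_ (cong₂ (λ x d → (- (+ 1) *ℤ x) *ℤ d) (e₁ zero) (det-cong (suc n) (minor N (suc zero)) (minor M zero) minor₁))
                  rest-neg) ⟩
  (+ 1 *ℤ M zero (suc zero)) *ℤ det (suc n) (minor M (suc zero)) +ℤ
    ((- (+ 1) *ℤ M zero zero) *ℤ det (suc n) (minor M zero) +ℤ - (+ 1) *ℤ rest M)
    ≡⟨ collect (M zero (suc zero)) (M zero zero) (det (suc n) (minor M zero)) (det (suc n) (minor M (suc zero))) (rest M) ⟩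
  - (term M zero +ℤ (term M (suc zero) +ℤ rest M)) ∎
  where
  open ≡-Reasoning
  term : Matrix (suc (suc n)) → Fin (suc (suc n)) → ℤ
  term A j = (sgn j *ℤ A zero j) *ℤ det (suc n) (minor A j)
  rest : Matrix (suc (suc n)) → ℤ
  rest A = sumFin n (λ j → term A (suc (suc j)))
  minor₀ : ∀ a b → minor N zero a b ≡ minor M (suc zero) a b
  minor₀ a zero    = e₁ (suc a)
  minor₀ a (suc b) = e₂ (suc a) b
  minor₁ : ∀ a b → minor N (suc zero) a b ≡ minor M zero a b
  minor₁ a zero    = e₀ (suc a)
  minor₁ a (suc b) = e₂ (suc a) b
  move-minus : ∀ x y → x *ℤ (- y) ≡ - (+ 1) *ℤ (x *ℤ y)
  move-minus = solve-∀
  collect : ∀ y x p q z → (+ 1 *ℤ y) *ℤ q +ℤ ((- (+ 1) *ℤ x) *ℤ p +ℤ - (+ 1) *ℤ z)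
                    ≡ - ((+ 1 *ℤ x) *ℤ p +ℤ ((- (+ 1) *ℤ y) *ℤ q +ℤ z))
  collect = solve-∀
  minor₂ : ∀ n (M N : Matrix (suc (suc n))) →
    (∀ i → N i zero ≡ M i (suc zero)) → (∀ i → N i (suc zero) ≡ M i zero) →
    (∀ i j → N i (suc (suc j)) ≡ M i (suc (suc j))) →
    ∀ j → det (suc n) (minor N (suc (suc j))) ≡ - det (suc n) (minor M (suc (suc j)))
  minor₂ (suc n) M N e₀ e₁ e₂ j =
    det-swap-columns n (minor M (suc (suc j))) (minor N (suc (suc j)))
      (λ i → e₀ (suc i)) (λ i → e₁ (suc i)) (λ i k → e₂ (suc i) (punchIn j k))
  rest-neg : rest N ≡ - (+ 1) *ℤ rest M
  rest-neg = trans
    (sumFin-cong n (λ j → trans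
      (cong₂ (λ x d → (sgn (suc (suc j)) *ℤ x) *ℤ d) (e₂ zero j) (minor₂ n M N e₀ e₁ e₂ j))
      (move-minus (sgn (suc (suc j)) *ℤ M zero (suc (suc j))) (det (suc n) (minor M (suc (suc j)))))))
    (sym (*-distribˡ-sumFin n (- (+ 1)) (λ j → term M (suc (suc j)))))

det-swap-rows : ∀ n (x y : Fin (suc (suc n)) → ℤ) (R : Fin n → Fin (suc (suc n)) → ℤ) →
  det (suc (suc n)) (x ∷ᵛ y ∷ᵛ R) ≡ - det (suc (suc n)) (y ∷ᵛ x ∷ᵛ R)
det-swap-rows n x y R = begin
  det (suc (suc n)) (x ∷ᵛ y ∷ᵛ R)                      ≡⟨ det-transpose (suc (suc n)) (x ∷ᵛ y ∷ᵛ R) ⟨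
  det (suc (suc n)) (λ i j → (x ∷ᵛ y ∷ᵛ R) j i)      ≡⟨ det-swap-columns n (λ i j → (y ∷ᵛ x ∷ᵛ R) j i) (λ i j → (x ∷ᵛ y ∷ᵛ R) j i)
                                                           (λ _ → refl) (λ _ → refl) (λ _ _ → refl) ⟩
  - det (suc (suc n)) (λ i j → (y ∷ᵛ x ∷ᵛ R) j i)    ≡⟨ cong -_ (det-transpose (suc (suc n)) (y ∷ᵛ x ∷ᵛ R)) ⟩
  - det (suc (suc n)) (y ∷ᵛ x ∷ᵛ R)                    ∎
  where open ≡-Reasoning

det-repeated-row : ∀ n (x : Fin (suc (suc n)) → ℤ) (R : Fin n → Fin (suc (suc n)) → ℤ) →
  det (suc (suc n)) (x ∷ᵛ x ∷ᵛ R) ≡ + 0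
det-repeated-row n x R = self-negative (det (suc (suc n)) (x ∷ᵛ x ∷ᵛ R)) (det-swap-rows n x x R)
  where
  self-negative : ∀ z → z ≡ - z → z ≡ + 0
  -- For a nonzero integer, `z ≡ - z` would equate different constructors.
  self-negative (+ zero) _ = refl

det-linear-row₀ : ∀ n (x y : Fin (suc n) → ℤ) (c : ℤ) (R : Fin n → Fin (suc n) → ℤ) →
  det (suc n) ((λ j → x j +ℤ c *ℤ y j) ∷ᵛ R) ≡ det (suc n) (x ∷ᵛ R) +ℤ c *ℤ det (suc n) (y ∷ᵛ R)
det-linear-row₀ n x y c R = begin
  sumFin (suc n) (λ j → (sgn j *ℤ (x j +ℤ c *ℤ y j)) *ℤ d j)
    ≡⟨ sumFin-cong (suc n) {λ j → (sgn j *ℤ (x j +ℤ c *ℤ y j)) *ℤ d j}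
                           {λ j → (sgn j *ℤ x j) *ℤ d j +ℤ c *ℤ ((sgn j *ℤ y j) *ℤ d j)}
         (λ j → split (sgn j) (x j) c (y j) (d j)) ⟩
  sumFin (suc n) (λ j → (sgn j *ℤ x j) *ℤ d j +ℤ c *ℤ ((sgn j *ℤ y j) *ℤ d j))
    ≡⟨ sumFin-distrib-+ (suc n) (λ j → (sgn j *ℤ x j) *ℤ d j) (λ j → c *ℤ ((sgn j *ℤ y j) *ℤ d j)) ⟩
  det (suc n) (x ∷ᵛ R) +ℤ sumFin (suc n) (λ j → c *ℤ ((sgn j *ℤ y j) *ℤ d j))
    ≡⟨ cong (det (suc n) (x ∷ᵛ R) +ℤ_) (*-distribˡ-sumFin (suc n) c (λ j → (sgn j *ℤ y j) *ℤ d j)) ⟨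
  det (suc n) (x ∷ᵛ R) +ℤ c *ℤ det (suc n) (y ∷ᵛ R) ∎
  where
  open ≡-Reasoning
  d : Fin (suc n) → ℤ
  d j = det n (λ a b → R a (punchIn j b))
  split : ∀ s a c b d → (s *ℤ (a +ℤ c *ℤ b)) *ℤ d ≡ (s *ℤ a) *ℤ d +ℤ c *ℤ ((s *ℤ b) *ℤ d)
  split = solve-∀

-- The multiple of `r` in the row just below it is removed by swapping that row to the top, where
-- linearity leaves a determinant with a repeated row. With `R zero` on top, the minors of the first
-- row again have `r` as their first row, and induction clears the other rows.
det-shear : ∀ n (r : Fin (suc n) → ℤ) (R : Fin n → Fin (suc n) → ℤ) (u : Fin n → ℤ) →
  det (suc n) (r ∷ᵛ (λ i j → R i j +ℤ u i *ℤ r j)) ≡ det (suc n) (r ∷ᵛ R)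
det-shear zero    r R u = refl
det-shear (suc n) r R u = begin
  Δ (r ∷ᵛ R⁺)
    ≡⟨ det-cong (suc (suc n)) (r ∷ᵛ R⁺) (r ∷ᵛ R⁺ zero ∷ᵛ tail⁺)
         (λ { zero j → refl ; (suc zero) j → refl ; (suc (suc i)) j → refl }) ⟩
  Δ (r ∷ᵛ R⁺ zero ∷ᵛ tail⁺)
    ≡⟨ det-swap-rows n r (R⁺ zero) tail⁺ ⟩
  - Δ (R⁺ zero ∷ᵛ r ∷ᵛ tail⁺)
    ≡⟨ cong -_ (det-linear-row₀ (suc n) (R zero) r (u zero) (r ∷ᵛ tail⁺)) ⟩
  - (Δ (R zero ∷ᵛ r ∷ᵛ tail⁺) +ℤ u zero *ℤ Δ (r ∷ᵛ r ∷ᵛ tail⁺))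
    ≡⟨ cong (λ z → - (Δ (R zero ∷ᵛ r ∷ᵛ tail⁺) +ℤ z))
         (trans (cong (u zero *ℤ_) (det-repeated-row n r tail⁺)) (ℤₚ.*-zeroʳ (u zero))) ⟩
  - (Δ (R zero ∷ᵛ r ∷ᵛ tail⁺) +ℤ + 0)
    ≡⟨ cong -_ (ℤₚ.+-identityʳ (Δ (R zero ∷ᵛ r ∷ᵛ tail⁺))) ⟩
  - Δ (R zero ∷ᵛ r ∷ᵛ tail⁺)
    ≡⟨ cong -_ (det-expand-cong (suc n) (R zero ∷ᵛ r ∷ᵛ tail⁺) (R zero ∷ᵛ r ∷ᵛ tail) (λ _ → refl) minors) ⟩
  - Δ (R zero ∷ᵛ r ∷ᵛ tail)
    ≡⟨ det-swap-rows n r (R zero) tail ⟨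
  Δ (r ∷ᵛ R zero ∷ᵛ tail)
    ≡⟨ det-cong (suc (suc n)) (r ∷ᵛ R zero ∷ᵛ tail) (r ∷ᵛ R)
         (λ { zero j → refl ; (suc zero) j → refl ; (suc (suc i)) j → refl }) ⟩
  Δ (r ∷ᵛ R) ∎
  where
  open ≡-Reasoning
  Δ : Matrix (suc (suc n)) → ℤ
  Δ = det (suc (suc n))
  R⁺ : Fin (suc n) → Fin (suc (suc n)) → ℤ
  R⁺ i j = R i j +ℤ u i *ℤ r j
  tail tail⁺ : Fin n → Fin (suc (suc n)) → ℤ
  tail i = R (suc i)
  tail⁺ i = R⁺ (suc i)
  minors : ∀ j → det (suc n) (minor (R zero ∷ᵛ r ∷ᵛ tail⁺) j) ≡ det (suc n) (minor (R zero ∷ᵛ r ∷ᵛ tail) j)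
  minors j =
    trans (det-cong (suc n) (minor (R zero ∷ᵛ r ∷ᵛ tail⁺) j) (r′ ∷ᵛ (λ i b → R′ i b +ℤ u (suc i) *ℤ r′ b))
            (λ { zero b → refl ; (suc a) b → refl }))
   (trans (det-shear n r′ R′ (λ i → u (suc i)))
          (det-cong (suc n) (r′ ∷ᵛ R′) (minor (R zero ∷ᵛ r ∷ᵛ tail) j) (λ { zero b → refl ; (suc a) b → refl })))
    where
    r′ : Fin (suc n) → ℤ
    r′ b = r (punchIn j b)
    R′ : Fin n → Fin (suc n) → ℤ
    R′ i b = R (suc i) (punchIn j b)

-- Row 0 of the product is row 0 of `X`, and the lower rows are those of `Y` plus multiples of it,
-- which `det-shear` removes. The minors of `X zero ∷ᵛ Y` along row 0 are products of the same kind,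
-- one size smaller.
det-unitriangular-* : ∀ n (L X : Matrix n) → (∀ i → L i i ≡ + 1) →
  (∀ i j → toℕ i < toℕ j → L i j ≡ + 0) →
  det n (λ i j → sumFin n (λ g → L i g *ℤ X g j)) ≡ det n X
det-unitriangular-* zero    L X diag upper = refl
det-unitriangular-* (suc n) L X diag upper = begin
  det (suc n) LX
    ≡⟨ det-cong (suc n) LX (X zero ∷ᵛ (λ i j → Y i j +ℤ L (suc i) zero *ℤ X zero j)) rows ⟩
  det (suc n) (X zero ∷ᵛ (λ i j → Y i j +ℤ L (suc i) zero *ℤ X zero j))
    ≡⟨ det-shear n (X zero) Y (λ i → L (suc i) zero) ⟩
  det (suc n) (X zero ∷ᵛ Y)
    ≡⟨ det-expand-cong n (X zero ∷ᵛ Y) X (λ _ → refl)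
         (λ j → det-unitriangular-* n (λ a b → L (suc a) (suc b)) (minor X j)
           (λ i → diag (suc i)) (λ a b a<b → upper (suc a) (suc b) (s≤s a<b))) ⟩
  det (suc n) X ∎
  where
  open ≡-Reasoning
  LX : Matrix (suc n)
  LX i j = sumFin (suc n) (λ g → L i g *ℤ X g j)
  Y : Fin n → Fin (suc n) → ℤ
  Y i j = sumFin n (λ g → L (suc i) (suc g) *ℤ X (suc g) j)
  rows : ∀ i j → LX i j ≡ (X zero ∷ᵛ (λ i j → Y i j +ℤ L (suc i) zero *ℤ X zero j)) i j
  rows zero j = trans
    (cong₂ _+ℤ_ (trans (cong (_*ℤ X zero j) (diag zero)) (ℤₚ.*-identityˡ (X zero j)))
                (sumFin-zero n (λ g → trans (cong (_*ℤ X (suc g) j) (upper zero (suc g) (s≤s z≤n)))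
                                            (ℤₚ.*-zeroˡ (X (suc g) j)))))
    (ℤₚ.+-identityʳ (X zero j))
  rows (suc i) j = ℤₚ.+-comm (L (suc i) zero *ℤ X zero j) (Y i j)

-- Tridiagonal matrices and their moments

shift : (ℕ → ℤ) → ℕ → ℤ
shift x n = x (suc n)

unit : ℕ → ℤ
unit zero    = + 1
unit (suc _) = + 0

tridiagonal : (ℕ → ℤ) → ℕ → ℕ → ℤ
tridiagonal t zero    zero    = t zero
tridiagonal t zero    (suc j) = unit j
tridiagonal t (suc i) zero    = unit i
tridiagonal t (suc i) (suc j) = tridiagonal (shift t) i j

continuant : (ℕ → ℤ) → ℕ → ℤ
continuant t zero          = + 1
continuant t (suc zero)    = t zero
continuant t (suc (suc n)) = t zero *ℤ continuant (shift t) (suc n) - continuant (shift (shift t)) n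

-- The definition of `continuant` peels off index 0, matching determinant expansion along the first
-- row. The recurrence for successive Hankel determinants needs the last index peeled off instead;
-- both expansions commute, which gives a two-step induction.
continuant-last : ∀ t n →
  continuant t (suc (suc n)) ≡ t (suc n) *ℤ continuant t (suc n) - continuant t n
continuant-last t zero = cong (_- + 1) (ℤₚ.*-comm (t zero) (t (suc zero)))
continuant-last t (suc zero) = base (t 0) (t 1) (t 2)
  where
  base : ∀ a b c → a *ℤ (b *ℤ c - + 1) - c ≡ c *ℤ (a *ℤ b - + 1) - a
  base = solve-∀
continuant-last t (suc (suc n)) = trans
  (cong₂ (λ x y → t 0 *ℤ x - y) (continuant-last (shift t) (suc n)) (continuant-last (shift (shift t)) n))
  (regroup (t 0) (t (suc (suc (suc n)))) (continuant (shift t) (suc (suc n))) (continuant (shift t) (suc n))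
           (continuant (shift (shift t)) (suc n)) (continuant (shift (shift t)) n))
  where
  regroup : ∀ a c p q r s → a *ℤ (c *ℤ p - q) - (c *ℤ r - s) ≡ c *ℤ (a *ℤ p - r) - (a *ℤ q - s)
  regroup = solve-∀

-- Only two entries of the first row can be nonzero. The minor `M₁` of the second has a first column
-- with a single nonzero entry, at the top, so a column expansion leaves the matrix with its first
-- two rows and columns removed.
det-tridiagonal : ∀ t n → det n (λ i j → tridiagonal t (toℕ i) (toℕ j)) ≡ continuant t n
det-tridiagonal t zero          = refl
det-tridiagonal t (suc zero)    = only (t 0)
  where
  only : ∀ a → (+ 1 *ℤ a) *ℤ + 1 +ℤ + 0 ≡ a
  only = solve-∀
det-tridiagonal t (suc (suc n)) = begin
  (+ 1 *ℤ t 0) *ℤ det (suc n) (λ i j → tridiagonal (shift t) (toℕ i) (toℕ j)) +ℤ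
    ((- (+ 1) *ℤ + 1) *ℤ det (suc n) M₁ +ℤ sumFin n far)
    ≡⟨ cong₂ (λ x y → (+ 1 *ℤ t 0) *ℤ x +ℤ y) (det-tridiagonal (shift t) (suc n))
        (cong₂ (λ x y → (- (+ 1) *ℤ + 1) *ℤ x +ℤ y) det-M₁ (sumFin-zero n far-zero)) ⟩
  (+ 1 *ℤ t 0) *ℤ continuant (shift t) (suc n) +ℤ
    ((- (+ 1) *ℤ + 1) *ℤ continuant (shift (shift t)) n +ℤ + 0)
    ≡⟨ tidy (t 0) (continuant (shift t) (suc n)) (continuant (shift (shift t)) n) ⟩
  t 0 *ℤ continuant (shift t) (suc n) - continuant (shift (shift t)) n ∎
  where
  open ≡-Reasoning
  T : Matrix (suc (suc n))
  T i j = tridiagonal t (toℕ i) (toℕ j)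
  M₁ : Matrix (suc n)
  M₁ = minor T (suc zero)
  far : Fin n → ℤ
  far j = (sgn (suc (suc j)) *ℤ + 0) *ℤ det (suc n) (minor T (suc (suc j)))
  vanish : ∀ s d → (s *ℤ + 0) *ℤ d ≡ + 0
  vanish = solve-∀
  far-zero : ∀ j → far j ≡ + 0
  far-zero j = vanish (sgn (suc (suc j))) (det (suc n) (minor T (suc (suc j))))
  tidy : ∀ a p q → (+ 1 *ℤ a) *ℤ p +ℤ ((- (+ 1) *ℤ + 1) *ℤ q +ℤ + 0) ≡ a *ℤ p - q
  tidy = solve-∀
  only : ∀ p → (+ 1 *ℤ + 1) *ℤ p +ℤ + 0 ≡ p
  only = solve-∀
  det-M₁ : det (suc n) M₁ ≡ continuant (shift (shift t)) n
  det-M₁ = trans (det-expand-column n M₁)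
    (trans (cong₂ (λ x y → (+ 1 *ℤ + 1) *ℤ x +ℤ y) (det-tridiagonal (shift (shift t)) n)
             (sumFin-zero n (λ i → vanish (sgn (suc i)) (det n (minor-column M₁ (suc i))))))
           (only (continuant (shift (shift t)) n)))

tridiagonal-sym : ∀ t i j → tridiagonal t i j ≡ tridiagonal t j i
tridiagonal-sym t zero    zero    = refl
tridiagonal-sym t zero    (suc j) = refl
tridiagonal-sym t (suc i) zero    = refl
tridiagonal-sym t (suc i) (suc j) = tridiagonal-sym (shift t) i j

-- Iterates and moments of the tridiagonal operator

apply : (ℕ → ℤ) → (ℕ → ℤ) → ℕ → ℤ
apply t x zero    = t zero *ℤ x zero +ℤ x 1
apply t x (suc g) = x g +ℤ t (suc g) *ℤ x (suc g) +ℤ x (suc (suc g))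

-- Truncating to size `n` loses only the term `x n` in the last row, and that term is zero.
tridiagonal-apply : ∀ n t x (g : Fin n) → x n ≡ + 0 →
  sumFin n (λ h → tridiagonal t (toℕ g) (toℕ h) *ℤ x (toℕ h)) ≡ apply t x (toℕ g)
tridiagonal-apply (suc zero) t x zero x₁≡0 = cong (t zero *ℤ x zero +ℤ_) (sym x₁≡0)
tridiagonal-apply (suc (suc n)) t x zero _ = trans
  (cong (λ z → t zero *ℤ x zero +ℤ (+ 1 *ℤ x 1 +ℤ z)) (sumFin-zero n (λ h → ℤₚ.*-zeroˡ (x (suc (suc (toℕ h)))))))
  (tidy (t zero *ℤ x zero) (x 1))
  where
  tidy : ∀ a b → a +ℤ (+ 1 *ℤ b +ℤ + 0) ≡ a +ℤ b
  tidy = solve-∀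
tridiagonal-apply (suc (suc n)) t x (suc zero) x≡0 = trans
  (cong (+ 1 *ℤ x 0 +ℤ_) (tridiagonal-apply (suc n) (shift t) (shift x) zero x≡0))
  (tidy (x 0) (t 1 *ℤ x 1) (x 2))
  where
  tidy : ∀ a b c → + 1 *ℤ a +ℤ (b +ℤ c) ≡ a +ℤ b +ℤ c
  tidy = solve-∀
tridiagonal-apply (suc (suc n)) t x (suc (suc g)) x≡0 = trans
  (cong (+ 0 *ℤ x 0 +ℤ_) (tridiagonal-apply (suc n) (shift t) (shift x) (suc g) x≡0))
  (trans (cong (_+ℤ apply (shift t) (shift x) (suc (toℕ g))) (ℤₚ.*-zeroˡ (x 0)))
         (ℤₚ.+-identityˡ _))

-- The matrix O of the header: for i, g ≥ 1 the entry iterate weight i g (weight being the diagonal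
-- of T) counts the admissible paths of length 2i - 1 from height 2g - 1 to height 0.
iterate : (ℕ → ℤ) → ℕ → ℕ → ℤ
iterate t zero    g       = unit g
iterate t (suc j) zero    = + 0
iterate t (suc j) (suc g) = apply t (iterate t j) (suc g)

iterate-above : ∀ t j g → j < g → iterate t j g ≡ + 0
iterate-above t zero    (suc g) _ = refl
iterate-above t (suc j) (suc g) (s≤s j<g)
  rewrite iterate-above t j g j<g
        | iterate-above t j (suc g) (ℕₚ.m<n⇒m<1+n j<g)
        | iterate-above t j (suc (suc g)) (ℕₚ.m<n⇒m<1+n (ℕₚ.m<n⇒m<1+n j<g))
        = cong (λ z → + 0 +ℤ z +ℤ + 0) (ℤₚ.*-zeroʳ (t (suc g)))

iterate-diagonal : ∀ t j → iterate t j j ≡ + 1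
iterate-diagonal t zero = refl
iterate-diagonal t (suc j)
  rewrite iterate-diagonal t j
        | iterate-above t j (suc j) (ℕₚ.n<1+n j)
        | iterate-above t j (suc (suc j)) (ℕₚ.m<n⇒m<1+n (ℕₚ.n<1+n j))
        = cong (λ z → + 1 +ℤ z +ℤ + 0) (ℤₚ.*-zeroʳ (t (suc j)))

-- T is symmetric, so ⟨T x , y⟩ and ⟨x , T y⟩, summed over the interior coordinates, differ only by
-- discrete Wronskians at the two ends; each side carries one of them.
green : ∀ n t x y →
  sumFin n (λ g → apply t x (suc (toℕ g)) *ℤ y (suc (toℕ g))) +ℤ (x n *ℤ y (suc n) - x (suc n) *ℤ y n)
  ≡ (x 0 *ℤ y 1 - x 1 *ℤ y 0) +ℤ sumFin n (λ g → x (suc (toℕ g)) *ℤ apply t y (suc (toℕ g)))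
green zero    t x y = ℤₚ.+-comm (+ 0) (x 0 *ℤ y 1 - x 1 *ℤ y 0)
green (suc n) t x y = trans
  (ℤₚ.+-assoc (apply t x 1 *ℤ y 1) Σˡ boundary)
  (trans (cong (apply t x 1 *ℤ y 1 +ℤ_) (green n (shift t) (shift x) (shift y)))
         (step (x 0) (x 1) (x 2) (t 1) (y 0) (y 1) (y 2) Σʳ))
  where
  Σˡ Σʳ boundary : ℤ
  Σˡ = sumFin n (λ g → apply t x (suc (suc (toℕ g))) *ℤ y (suc (suc (toℕ g))))
  Σʳ = sumFin n (λ g → x (suc (suc (toℕ g))) *ℤ apply t y (suc (suc (toℕ g))))
  boundary = x (suc n) *ℤ y (suc (suc n)) - x (suc (suc n)) *ℤ y (suc n)
  step : ∀ x₀ x₁ x₂ t y₀ y₁ y₂ S →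
    (x₀ +ℤ t *ℤ x₁ +ℤ x₂) *ℤ y₁ +ℤ ((x₁ *ℤ y₂ - x₂ *ℤ y₁) +ℤ S)
    ≡ (x₀ *ℤ y₁ - x₁ *ℤ y₀) +ℤ (x₁ *ℤ (y₀ +ℤ t *ℤ y₁ +ℤ y₂) +ℤ S)
  step = solve-∀

-- Entry (0, j) of O T Oᵗ. By `iterate-pairing` the entry (i, j) depends only on i + j, so this
-- product is a Hankel matrix.
moment : (ℕ → ℤ) → ℕ → ℤ
moment t j = apply t (iterate t j) 0

-- Symmetry of T moves one step from the first iterate to the second, down to iterate t 0 = unit.
iterate-pairing : ∀ t n i j → i ≤ n →
  sumFin (suc n) (λ g → iterate t i (toℕ g) *ℤ apply t (iterate t j) (toℕ g)) ≡ moment t (i + j)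
iterate-pairing t n zero j _ = trans
  (cong₂ _+ℤ_ (ℤₚ.*-identityˡ (moment t j)) (sumFin-zero n (λ g → ℤₚ.*-zeroˡ (apply t (iterate t j) (suc (toℕ g))))))
  (ℤₚ.+-identityʳ (moment t j))
iterate-pairing t n (suc i) j i<n = begin
  + 0 *ℤ apply t y 0 +ℤ Σ₁
    ≡⟨ start (apply t y 0) Σ₁ (y′ (suc n)) (y′ n) ⟩
  Σ₁ +ℤ (+ 0 *ℤ y′ (suc n) - + 0 *ℤ y′ n)
    -- `iterate t i` vanishes above index `i`, so the boundary term at the far end is zero.
    ≡⟨ cong₂ (λ a b → Σ₁ +ℤ (a *ℤ y′ (suc n) - b *ℤ y′ n))
         (iterate-above t i n i<n) (iterate-above t i (suc n) (ℕₚ.m<n⇒m<1+n i<n)) ⟨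
  Σ₁ +ℤ (x n *ℤ y′ (suc n) - x (suc n) *ℤ y′ n)
    ≡⟨ green n t x y′ ⟩
  (x 0 *ℤ y′ 1 - x 1 *ℤ + 0) +ℤ Σ₂
    -- Since `y′ 0` is zero, the boundary term at the near end is exactly the missing summand at
    -- coordinate 0.
    ≡⟨ finish (x 0) (x 1) (t 0) (y′ 1) Σ₂ ⟩
  x 0 *ℤ apply t y′ 0 +ℤ Σ₂
    ≡⟨ iterate-pairing t n i (suc j) (ℕₚ.<⇒≤ i<n) ⟩
  moment t (i + suc j)
    ≡⟨ cong (moment t) (ℕₚ.+-suc i j) ⟩
  moment t (suc (i + j)) ∎
  where
  open ≡-Reasoning
  x y y′ : ℕ → ℤ
  x = iterate t i
  y = iterate t j
  y′ = iterate t (suc j)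
  Σ₁ Σ₂ : ℤ
  Σ₁ = sumFin n (λ g → apply t x (suc (toℕ g)) *ℤ y′ (suc (toℕ g)))
  Σ₂ = sumFin n (λ g → x (suc (toℕ g)) *ℤ apply t y′ (suc (toℕ g)))
  start : ∀ a S p q → + 0 *ℤ a +ℤ S ≡ S +ℤ (+ 0 *ℤ p - + 0 *ℤ q)
  start = solve-∀
  finish : ∀ x₀ x₁ t₀ y₁ S → (x₀ *ℤ y₁ - x₁ *ℤ + 0) +ℤ S ≡ x₀ *ℤ (t₀ *ℤ + 0 +ℤ y₁) +ℤ S
  finish = solve-∀

-- The left factor O is stripped off first; transposing moves the other one to the left, where the
-- same lemma strips it, and T remains.
hankel-moment : ∀ t n → hankel (moment t) n ≡ continuant t n
hankel-moment t zero    = refl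
hankel-moment t (suc n) = begin
  det (suc n) H
    ≡⟨ det-cong (suc n) H (λ i j → sumFin (suc n) (λ g → O i g *ℤ Y g j))
         (λ i j → sym (iterate-pairing t n (toℕ i) (toℕ j) (Finₚ.toℕ≤pred[n] i))) ⟩
  det (suc n) (λ i j → sumFin (suc n) (λ g → O i g *ℤ Y g j))
    ≡⟨ det-unitriangular-* (suc n) O Y diagonal upper ⟩
  det (suc n) Y
    ≡⟨ det-transpose (suc n) Y ⟨
  det (suc n) (λ j g → Y g j)
    ≡⟨ det-cong (suc n) (λ j g → Y g j) (λ j g → sumFin (suc n) (λ h → O j h *ℤ T h g)) transposed ⟩
  det (suc n) (λ j g → sumFin (suc n) (λ h → O j h *ℤ T h g))
    ≡⟨ det-unitriangular-* (suc n) O T diagonal upper ⟩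
  det (suc n) T
    ≡⟨ det-tridiagonal t (suc n) ⟩
  continuant t (suc n) ∎
  where
  open ≡-Reasoning
  H O Y T : Matrix (suc n)
  H i j = moment t (toℕ i + toℕ j)
  O i g = iterate t (toℕ i) (toℕ g)
  Y g j = apply t (iterate t (toℕ j)) (toℕ g)
  T g h = tridiagonal t (toℕ g) (toℕ h)
  diagonal : ∀ i → O i i ≡ + 1
  diagonal i = iterate-diagonal t (toℕ i)
  upper : ∀ i j → toℕ i < toℕ j → O i j ≡ + 0
  upper i j = iterate-above t (toℕ i) (toℕ j)
  transposed : ∀ j g → Y g j ≡ sumFin (suc n) (λ h → O j h *ℤ T h g)
  transposed j g = trans
    (sym (tridiagonal-apply (suc n) t (iterate t (toℕ j)) g (iterate-above t (toℕ j) (suc n) (Finₚ.toℕ<n j))))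
    (sumFin-cong (suc n) {λ h → T g h *ℤ O j h} {λ h → O j h *ℤ T h g}
      (λ h → trans (ℤₚ.*-comm (T g h) (O j h)) (cong (O j h *ℤ_) (tridiagonal-sym t (toℕ g) (toℕ h)))))

-- Counting restricted Dyck paths

module _ {A : Set} where
  countTrue-++ : ∀ (f : A → Bool) xs ys → countTrue f (xs ++ ys) ≡ countTrue f xs + countTrue f ys
  countTrue-++ f []       ys = refl
  countTrue-++ f (x ∷ xs) ys with f x
  ... | true  = cong suc (countTrue-++ f xs ys)
  ... | false = countTrue-++ f xs ys

  countTrue-cong : ∀ {f g : A → Bool} → (∀ x → f x ≡ g x) → ∀ xs → countTrue f xs ≡ countTrue g xs
  countTrue-cong eq []       = refl
  countTrue-cong {f} {g} eq (x ∷ xs) =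
    cong₂ (λ b k → if b then suc k else k) (eq x) (countTrue-cong eq xs)

  countTrue-false : ∀ {f : A → Bool} → (∀ x → f x ≡ false) → ∀ xs → countTrue f xs ≡ 0
  countTrue-false eq []       = refl
  countTrue-false eq (x ∷ xs) rewrite eq x = countTrue-false eq xs

countTrue-map : ∀ {A B : Set} (f : B → Bool) (g : A → B) xs → countTrue f (map g xs) ≡ countTrue (f ∘ g) xs
countTrue-map f g []       = refl
countTrue-map f g (x ∷ xs) = cong (λ k → if f (g x) then suc k else k) (countTrue-map f g xs)

indicator : Bool → ℕ
indicator true  = 1
indicator false = 0

module Paths (P : ℕ → Bool) where

  admissible : ℕ → List Bool → Bool
  admissible h w = isDyckFrom h w ∧ noPeakIn P h w

  -- pathsAfterUp remembers that the last step was up, so that an immediate down step makes a peak.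
  paths pathsAfterUp : ℕ → ℕ → ℕ
  paths L h = countTrue (admissible h) (words L)
  pathsAfterUp L h = countTrue (λ w → admissible h (true ∷ w)) (words L)

  countTrue-words : ∀ (f : List Bool → Bool) L → countTrue f (words (suc L)) ≡
    countTrue (λ w → f (true ∷ w)) (words L) + countTrue (λ w → f (false ∷ w)) (words L)
  countTrue-words f L = trans (countTrue-++ f (map (true ∷_) (words L)) (map (false ∷_) (words L)))
    (cong₂ _+_ (countTrue-map f (true ∷_) (words L)) (countTrue-map f (false ∷_) (words L)))

  paths-suc-zero : ∀ L → paths (suc L) 0 ≡ pathsAfterUp L 0
  paths-suc-zero L = trans (countTrue-words (admissible 0) L)
    (trans (cong (λ k → pathsAfterUp L 0 + k) (countTrue-false (λ _ → refl) (words L))) (ℕₚ.+-identityʳ _))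

  paths-suc-suc : ∀ L h → paths (suc L) (suc h) ≡ pathsAfterUp L (suc h) + paths L h
  paths-suc-suc L h = countTrue-words (admissible (suc h)) L

  -- After an up step to `suc h` the continuation is arbitrary, except that a down step makes a peak
  -- at `suc h`. Adding back the paths lost when that peak is forbidden gives all paths from
  -- `suc h`; the additive form avoids subtraction in ℕ.
  pathsAfterUp-suc : ∀ L h →
    pathsAfterUp (suc L) h + indicator (P (suc h)) * paths L h ≡ paths (suc L) (suc h)
  pathsAfterUp-suc L h
    rewrite paths-suc-suc L h | countTrue-words (λ w → admissible h (true ∷ w)) L with P (suc h)
  ... | false = ℕₚ.+-identityʳ _
  ... | true  = trans
    (cong₂ (λ a b → pathsAfterUp L (suc h) + a + b)
      (countTrue-false (λ w → Boolₚ.∧-zeroʳ (isDyckFrom h w)) (words L)) (ℕₚ.*-identityˡ (paths L h)))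
    (cong (_+ paths L h) (ℕₚ.+-identityʳ _))

  paths-step-zero : ∀ L → paths (suc (suc L)) 0 + indicator (P 1) * paths L 0 ≡ paths (suc L) 1
  paths-step-zero L = trans (cong (_+ indicator (P 1) * paths L 0) (paths-suc-zero (suc L))) (pathsAfterUp-suc L 0)

  -- Eliminates `pathsAfterUp`, leaving a recurrence in `paths` alone that reaches back two lengths.
  paths-step-suc : ∀ L h → paths (suc (suc L)) (suc h) + indicator (P (suc (suc h))) * paths L (suc h)
    ≡ paths (suc L) (suc (suc h)) + paths (suc L) h
  paths-step-suc L h = begin
    paths (suc (suc L)) (suc h) + p              ≡⟨ cong (_+ p) (paths-suc-suc (suc L) h) ⟩
    pathsAfterUp (suc L) (suc h) + down + p      ≡⟨ ℕₚ.+-assoc (pathsAfterUp (suc L) (suc h)) down p ⟩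
    pathsAfterUp (suc L) (suc h) + (down + p)    ≡⟨ cong (λ k → pathsAfterUp (suc L) (suc h) + k) (ℕₚ.+-comm down p) ⟩
    pathsAfterUp (suc L) (suc h) + (p + down)    ≡⟨ ℕₚ.+-assoc (pathsAfterUp (suc L) (suc h)) p down ⟨
    pathsAfterUp (suc L) (suc h) + p + down      ≡⟨ cong (_+ down) (pathsAfterUp-suc L (suc h)) ⟩
    paths (suc L) (suc (suc h)) + down           ∎
    where
    open ≡-Reasoning
    p = indicator (P (suc (suc h))) * paths L (suc h)
    down = paths (suc L) h

  weight : ℕ → ℤ
  weight zero    = + 1
  weight (suc g) = + 2 - + indicator (P (suc g * 2))

  module _ (odd-free : ∀ g → P (suc (g * 2)) ≡ false) where

    private
      o : ℕ → ℕ → ℤ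
      o = iterate weight

      step-zero : ∀ L → paths (suc (suc L)) 0 ≡ paths (suc L) 1
      step-zero L with eq ← paths-step-zero L rewrite odd-free 0 = trans (sym (ℕₚ.+-identityʳ _)) eq

      step-even : ∀ L g → paths (suc (suc L)) (suc g * 2) ≡
        paths (suc L) (suc (suc g * 2)) + paths (suc L) (suc (g * 2))
      step-even L g with eq ← paths-step-suc L (suc (g * 2)) rewrite odd-free (suc g) =
        trans (sym (ℕₚ.+-identityʳ _)) eq

      step-odd : ∀ L g → + paths (suc (suc L)) (suc (g * 2)) ≡
        + paths (suc L) (suc g * 2) +ℤ + paths (suc L) (g * 2)
          - + indicator (P (suc g * 2)) *ℤ + paths L (suc (g * 2))
      step-odd L g = begin
        + paths (suc (suc L)) (suc (g * 2))                   ≡⟨ add-sub (+ paths (suc (suc L)) (suc (g * 2))) (+ (e * c)) ⟩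
        + (paths (suc (suc L)) (suc (g * 2)) + e * c) - + (e * c)
                                                              ≡⟨ cong₂ (λ a b → + a - b) (paths-step-suc L (g * 2)) (ℤₚ.pos-* e c) ⟩
        + paths (suc L) (suc g * 2) +ℤ + paths (suc L) (g * 2) - + e *ℤ + c ∎
        where
        open ≡-Reasoning
        e = indicator (P (suc g * 2))
        c = paths L (suc (g * 2))
        add-sub : ∀ a b → a ≡ a +ℤ b - b
        add-sub = solve-∀

    -- Mutual induction on the length. From an even height the first possible peak is odd, hence
    -- unrestricted, and the count is the sum over the two neighbouring heights. From an odd height
    -- two such sums overlap in `o (suc j) (suc g)`, and the correction for a forbidden peak turns
    -- its coefficient 2 into `weight (suc g)`. The value `o j 0` is 1 for the empty path and 0 for
    -- larger `j`, where no height below 0 exists.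
    paths-even : ∀ j g → + paths (j * 2) (g * 2) ≡ o j g +ℤ o j (suc g)
    paths-odd : ∀ j g → + paths (suc (j * 2)) (suc (g * 2)) ≡ o (suc j) (suc g)

    paths-even zero    zero    = refl
    paths-even zero    (suc g) = refl
    paths-even (suc j) zero    = begin
      + paths (suc j * 2) 0          ≡⟨ cong +_ (step-zero (j * 2)) ⟩
      + paths (suc (j * 2)) 1        ≡⟨ paths-odd j 0 ⟩
      o (suc j) 1                    ≡⟨ ℤₚ.+-identityˡ (o (suc j) 1) ⟨
      + 0 +ℤ o (suc j) 1             ∎
      where open ≡-Reasoning
    paths-even (suc j) (suc g) = begin
      + paths (suc j * 2) (suc g * 2)                        ≡⟨ cong +_ (step-even (j * 2) g) ⟩
      + paths (suc (j * 2)) (suc (suc g * 2)) +ℤ + paths (suc (j * 2)) (suc (g * 2))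
                                                             ≡⟨ cong₂ _+ℤ_ (paths-odd j (suc g)) (paths-odd j g) ⟩
      o (suc j) (suc (suc g)) +ℤ o (suc j) (suc g)           ≡⟨ ℤₚ.+-comm (o (suc j) (suc (suc g))) (o (suc j) (suc g)) ⟩
      o (suc j) (suc g) +ℤ o (suc j) (suc (suc g))           ∎
      where open ≡-Reasoning

    paths-odd zero    g = begin
      + paths 1 (suc (g * 2))                                  ≡⟨ cong +_ (paths-suc-suc 0 (g * 2)) ⟩
      + paths 0 (g * 2)                                        ≡⟨ paths-even 0 g ⟩
      o 0 g +ℤ + 0                                             ≡⟨ tidy (o 0 g) (weight (suc g)) ⟩
      o 0 g +ℤ weight (suc g) *ℤ + 0 +ℤ + 0                     ∎
      where
      open ≡-Reasoning
      tidy : ∀ a w → a +ℤ + 0 ≡ a +ℤ w *ℤ + 0 +ℤ + 0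
      tidy = solve-∀
    paths-odd (suc j) g = begin
      + paths (suc (suc j * 2)) (suc (g * 2))
        ≡⟨ step-odd (suc (j * 2)) g ⟩
      + paths (suc j * 2) (suc g * 2) +ℤ + paths (suc j * 2) (g * 2) - e *ℤ + paths (suc (j * 2)) (suc (g * 2))
        ≡⟨ cong₂ (λ a b → a - e *ℤ b) (cong₂ _+ℤ_ (paths-even (suc j) (suc g)) (paths-even (suc j) g)) (paths-odd j g) ⟩
      (o (suc j) (suc g) +ℤ o (suc j) (suc (suc g))) +ℤ (o (suc j) g +ℤ o (suc j) (suc g)) - e *ℤ o (suc j) (suc g)
        ≡⟨ collect (o (suc j) g) (o (suc j) (suc g)) (o (suc j) (suc (suc g))) e ⟩
      o (suc j) g +ℤ (+ 2 - e) *ℤ o (suc j) (suc g) +ℤ o (suc j) (suc (suc g)) ∎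
      where
      open ≡-Reasoning
      e = + indicator (P (suc g * 2))
      collect : ∀ a b c e → (b +ℤ c) +ℤ (a +ℤ b) - e *ℤ b ≡ a +ℤ (+ 2 - e) *ℤ b +ℤ c
      collect = solve-∀

    paths-moment : ∀ n → + paths (2 * n) 0 ≡ moment weight n
    paths-moment n = begin
      + paths (2 * n) 0       ≡⟨ cong (λ k → + paths k 0) (ℕₚ.*-comm 2 n) ⟩
      + paths (n * 2) 0       ≡⟨ paths-even n 0 ⟩
      o n 0 +ℤ o n 1          ≡⟨ cong (_+ℤ o n 1) (ℤₚ.*-identityˡ (o n 0)) ⟨
      moment weight n         ∎
      where open ≡-Reasoning

-- The sections of the Hankel determinant sequence

module Recurrence (e : ℕ → Bool) (D : ℕ → ℤ)
  (rec : ∀ n → D (suc (suc n)) ≡ (+ 2 - + indicator (e (suc n))) *ℤ D (suc n) - D n) where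

  -- The progression has first term a at index b + 1 and is extended backwards to index b.
  StartsProgression : ℕ → ℤ → ℤ → Set
  StartsProgression b a d = D b ≡ a - d × D (suc b) ≡ a

  Free : ℕ → ℕ → Set
  Free b L = ∀ g → b < g → g < b + L → e g ≡ false

  -- Where `e` is false the recurrence says that the second difference vanishes. It has order two,
  -- so the induction carries two consecutive terms.
  progression : ∀ {b a d L} → StartsProgression b a d → Free b L → ∀ i → i < L →
    D (b + i) ≡ (a +ℤ + i *ℤ d) - d × D (suc (b + i)) ≡ a +ℤ + i *ℤ d
  progression {b} {a} {d} (D-b , D-1+b) free zero i<L =
      trans (cong D (ℕₚ.+-identityʳ b)) (trans D-b (cong (_- d) (first a d)))
    , trans (cong (λ n → D (suc n)) (ℕₚ.+-identityʳ b)) (trans D-1+b (first a d))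
    where
    first : ∀ a d → a ≡ a +ℤ + 0 *ℤ d
    first = solve-∀
  progression {b} {a} {d} {L} start free (suc i) i<L rewrite ℕₚ.+-suc b i =
    trans D-1+n (shift-index a d (+ i)) , (begin
      D (suc (suc (b + i)))
        ≡⟨ rec (b + i) ⟩
      (+ 2 - + indicator (e (suc (b + i)))) *ℤ D (suc (b + i)) - D (b + i)
        ≡⟨ cong (λ x → (+ 2 - + indicator x) *ℤ D (suc (b + i)) - D (b + i)) not-bad ⟩
      + 2 *ℤ D (suc (b + i)) - D (b + i)
        ≡⟨ cong₂ (λ x y → + 2 *ℤ x - y) D-1+n D-n ⟩
      + 2 *ℤ (a +ℤ + i *ℤ d) - ((a +ℤ + i *ℤ d) - d)
        ≡⟨ next-term a d (+ i) ⟩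
      a +ℤ (+ 1 +ℤ + i) *ℤ d ∎)
    where
    open ≡-Reasoning
    previous = progression start free i (ℕₚ.<-trans (ℕₚ.n<1+n i) i<L)
    D-n = proj₁ previous
    D-1+n = proj₂ previous
    not-bad : e (suc (b + i)) ≡ false
    not-bad = free (suc (b + i)) (s≤s (ℕₚ.m≤m+n b i))
      (subst (_< b + L) (ℕₚ.+-suc b i) (ℕₚ.+-monoʳ-< b i<L))
    shift-index : ∀ a d i → a +ℤ i *ℤ d ≡ (a +ℤ (+ 1 +ℤ i) *ℤ d) - d
    shift-index = solve-∀
    next-term : ∀ a d i → + 2 *ℤ (a +ℤ i *ℤ d) - ((a +ℤ i *ℤ d) - d) ≡ a +ℤ (+ 1 +ℤ i) *ℤ d
    next-term = solve-∀

  -- At a forbidden index the coefficient drops to 1, so the next term is the difference of the last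
  -- two, namely `d`.
  turn : ∀ {b a d} L → 0 < L → StartsProgression b a d → Free b L → e (b + L) ≡ true →
    StartsProgression (b + L) d (d - (a +ℤ + (L ∸ 1) *ℤ d))
  turn {b} {a} {d} (suc i) _ start free bad rewrite ℕₚ.+-suc b i =
    -- The last term of the old progression, read as the new one extended backwards, fixes the new
    -- difference.
    trans D-1+n (recover (a +ℤ + i *ℤ d) d) , (begin
      D (suc (suc (b + i)))
        ≡⟨ rec (b + i) ⟩
      (+ 2 - + indicator (e (suc (b + i)))) *ℤ D (suc (b + i)) - D (b + i)
        ≡⟨ cong (λ x → (+ 2 - + indicator x) *ℤ D (suc (b + i)) - D (b + i)) bad ⟩
      + 1 *ℤ D (suc (b + i)) - D (b + i)
        ≡⟨ cong₂ (λ x y → + 1 *ℤ x - y) D-1+n D-n ⟩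
      + 1 *ℤ (a +ℤ + i *ℤ d) - ((a +ℤ + i *ℤ d) - d)
        ≡⟨ difference (a +ℤ + i *ℤ d) d ⟩
      d ∎)
    where
    open ≡-Reasoning
    last-step = progression start (λ g b<g g<b+L → free g b<g (subst (g <_) (ℕₚ.+-suc b i) g<b+L)) i (ℕₚ.n<1+n i)
    D-n = proj₁ last-step
    D-1+n = proj₂ last-step
    recover : ∀ x d → x ≡ d - (d - x)
    recover = solve-∀
    difference : ∀ x d → + 1 *ℤ x - (x - d) ≡ d
    difference = solve-∀

-- Residues and membership in the forbidden set

%-≡⇒shifts-≡ : ∀ a b m .{{_ : NonZero m}} → a % m ≡ b % m → ∃₂ λ u v → a + u * m ≡ b + v * m
%-≡⇒shifts-≡ a b m eq = b / m , a / m , (begin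
  a + b / m * m                       ≡⟨ cong (_+ b / m * m) (m≡m%n+[m/n]*n a m) ⟩
  a % m + a / m * m + b / m * m       ≡⟨ cong (λ r → r + a / m * m + b / m * m) eq ⟩
  b % m + a / m * m + b / m * m       ≡⟨ swap (b % m) (a / m * m) (b / m * m) ⟩
  b % m + b / m * m + a / m * m       ≡⟨ cong (_+ a / m * m) (m≡m%n+[m/n]*n b m) ⟨
  b + a / m * m                       ∎)
  where
  open ≡-Reasoning
  swap : ∀ x y z → x + y + z ≡ x + z + y
  swap = solve-∀ℕ

suc-% : ∀ j n .{{_ : NonZero n}} → suc j % n ≡ suc (j % n) % n
suc-% j n = trans (%-congˡ {o = n} (cong suc (m≡m%n+[m/n]*n j n))) ([m+kn]%n≡m%n (suc (j % n)) (j / n) n)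

-- A cyclic index either advances by one or wraps to zero; these are the two branches of `tlen`.
mod-suc : ∀ k j →
    (toℕ (j mod suc k) < k × toℕ (suc j mod suc k) ≡ suc (toℕ (j mod suc k)))
  ⊎ (toℕ (j mod suc k) ≡ k × suc j mod suc k ≡ zero)
mod-suc k j with ℕₚ.m≤n⇒m<n∨m≡n (m%n<n j (suc k))
... | inj₁ 1+r<n = inj₁ (subst (_< k) (sym r≡) (ℕₚ.≤-pred 1+r<n) ,
        trans (Finₚ.toℕ-fromℕ< (m%n<n (suc j) (suc k)))
          (trans (suc-% j (suc k)) (trans (m<n⇒m%n≡m 1+r<n) (cong suc (sym r≡)))))
  where
  r≡ : toℕ (j mod suc k) ≡ j % suc k
  r≡ = Finₚ.toℕ-fromℕ< (m%n<n j (suc k))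
... | inj₂ 1+r≡n = inj₂ (trans (Finₚ.toℕ-fromℕ< (m%n<n j (suc k))) (ℕₚ.suc-injective 1+r≡n) ,
        Finₚ.toℕ-injective (trans (Finₚ.toℕ-fromℕ< (m%n<n (suc j) (suc k)))
          (trans (suc-% j (suc k)) (trans (cong (_% suc k) 1+r≡n) (n%n≡0 (suc k))))))

sAt-toℕ : ∀ k (s : Fin (suc k) → ℕ) i → sAt k s (toℕ i) ≡ s i
sAt-toℕ k       s zero    = refl
sAt-toℕ (suc k) s (suc i) = sAt-toℕ k (λ x → s (suc x)) i

inMV-true : ∀ m .{{_ : NonZero m}} k (s : Fin (suc k) → ℕ) h i →
  1 ≤ h → h % m ≡ (2 * s i) % m → inMV m (Vof k s) h ≡ true
inMV-true m k s h i 1≤h eq = Equivalence.to Boolₚ.T-≡ (Equivalence.from Boolₚ.T-∧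
  (ℕₚ.≤⇒≤ᵇ 1≤h , Anyₚ.any⁺ _ (Anyₚ.map⁺ (lose (∈-allFin i) (ℕₚ.≡⇒≡ᵇ (h % m) ((2 * s i) % m) eq)))))

inMV-false : ∀ m .{{_ : NonZero m}} k (s : Fin (suc k) → ℕ) h →
  (∀ i → h % m ≢ (2 * s i) % m) → inMV m (Vof k s) h ≡ false
inMV-false m k s h avoid = Boolₚ.¬-not λ h∈ →
  let (i , _ , T≡) = find (Anyₚ.map⁻ (Anyₚ.any⁻ (λ j → (h % m) ≡ᵇ (j % m)) (Vof k s)
                       (proj₂ (Equivalence.to (Boolₚ.T-∧ {x = 1 ≤ᵇ h}) (Equivalence.from Boolₚ.T-≡ h∈)))))
  in avoid i (ℕₚ.≡ᵇ⇒≡ (h % m) ((2 * s i) % m) T≡)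

-- Forbidden half-heights modulo `p`, the half of `m`

module Sections (m : ℕ) .{{_ : NonZero m}} (k : ℕ) (s : Fin (suc k) → ℕ) (p : ℕ) (m≡p*2 : m ≡ p * 2)
  (s-pos : ∀ i → 1 ≤ s i) (s-mono : ∀ i j → i <ᶠ j → s i < s j) (s-bound : ∀ i → s i ≤ p) where

  bad : ℕ → Bool
  bad h = inMV m (Vof k s) h

  s-mono-≤ : ∀ i j → toℕ i ≤ toℕ j → s i ≤ s j
  s-mono-≤ i j i≤j with ℕₚ.m≤n⇒m<n∨m≡n i≤j
  ... | inj₁ i<j = ℕₚ.<⇒≤ (s-mono i j i<j)
  ... | inj₂ i≡j = ℕₚ.≤-reflexive (cong s (Finₚ.toℕ-injective i≡j))

  odd-free : ∀ g → bad (suc (g * 2)) ≡ false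
  odd-free g = inMV-false m k s (suc (g * 2)) λ i eq →
    let (u , v , eq′) = %-≡⇒shifts-≡ (suc (g * 2)) (2 * s i) m eq
    in ℕₚ.even≢odd (s i + v * p) (g + u * p) (sym (begin
      suc (2 * (g + u * p))     ≡⟨ cong suc (lhs g u p) ⟩
      suc (g * 2 + u * (p * 2)) ≡⟨ cong (λ n → suc (g * 2 + u * n)) m≡p*2 ⟨
      suc (g * 2 + u * m)       ≡⟨ eq′ ⟩
      2 * s i + v * m           ≡⟨ cong (λ n → 2 * s i + v * n) m≡p*2 ⟩
      2 * s i + v * (p * 2)     ≡⟨ rhs (s i) v p ⟩
      2 * (s i + v * p)         ∎))
    where
    open ≡-Reasoning
    lhs : ∀ g u p → 2 * (g + u * p) ≡ g * 2 + u * (p * 2)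
    lhs = solve-∀ℕ
    rhs : ∀ x v p → 2 * x + v * (p * 2) ≡ 2 * (x + v * p)
    rhs = solve-∀ℕ

  bad-at : ∀ i q → bad ((s i + q * p) * 2) ≡ true
  bad-at i q = inMV-true m k s ((s i + q * p) * 2) i
    (ℕₚ.≤-trans (ℕₚ.≤-trans (s-pos i) (ℕₚ.m≤m+n (s i) (q * p))) (ℕₚ.m≤m*n (s i + q * p) 2))
    (trans (%-congˡ {o = m} (trans (expand (s i) q p) (cong (λ n → 2 * s i + q * n) (sym m≡p*2))))
           ([m+kn]%n≡m%n (2 * s i) q m))
    where
    expand : ∀ x q p → (x + q * p) * 2 ≡ 2 * x + q * (p * 2)
    expand = solve-∀ℕ

  -- If `g` is congruent to `s i` modulo `p`, there are three cases: they are equal, against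
  -- `avoid`; or `g` is at least `p + s i`, hence at least `p + s zero`; or `s i` is at least
  -- `p + g`, hence above `p`.
  free-at : ∀ g q → 1 ≤ g → g < p + s zero → (∀ i → s i ≢ g) → bad ((g + q * p) * 2) ≡ false
  free-at g q 1≤g g<p+s₀ avoid = inMV-false m k s ((g + q * p) * 2) λ i eq →
    let (u , v , eq′) = %-≡⇒shifts-≡ ((g + q * p) * 2) (2 * s i) m eq
    in impossible i (q + u) v (ℕₚ.*-cancelˡ-≡ (g + (q + u) * p) (s i + v * p) 2 (begin
      2 * (g + (q + u) * p)           ≡⟨ lhs g q u p ⟩
      (g + q * p) * 2 + u * (p * 2)   ≡⟨ cong (λ n → (g + q * p) * 2 + u * n) m≡p*2 ⟨
      (g + q * p) * 2 + u * m         ≡⟨ eq′ ⟩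
      2 * s i + v * m                 ≡⟨ cong (λ n → 2 * s i + v * n) m≡p*2 ⟩
      2 * s i + v * (p * 2)           ≡⟨ rhs (s i) v p ⟩
      2 * (s i + v * p)               ∎))
    where
    open ≡-Reasoning
    lhs : ∀ g q u p → 2 * (g + (q + u) * p) ≡ (g + q * p) * 2 + u * (p * 2)
    lhs = solve-∀ℕ
    rhs : ∀ x v p → 2 * x + v * (p * 2) ≡ 2 * (x + v * p)
    rhs = solve-∀ℕ
    larger : ∀ x a d p → x + suc (a + d) * p ≡ (p + x + d * p) + a * p
    larger = solve-∀ℕ
    impossible : ∀ i a v → g + a * p ≡ s i + v * p → ⊥
    impossible i a v eq with compare a v
    ... | equal _ = avoid i (sym (ℕₚ.+-cancelʳ-≡ (a * p) g (s i) eq))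
    ... | less _ d = ℕₚ.<-irrefl (sym g≡) (ℕₚ.<-≤-trans g<p+s₀
          (ℕₚ.≤-trans (ℕₚ.+-monoʳ-≤ p (s-mono-≤ zero i z≤n)) (ℕₚ.m≤m+n (p + s i) (d * p))))
      where
      g≡ : p + s i + d * p ≡ g
      g≡ = sym (ℕₚ.+-cancelʳ-≡ (a * p) g (p + s i + d * p) (trans eq (larger (s i) a d p)))
    ... | greater _ d = ℕₚ.<-irrefl s≡ (ℕₚ.≤-<-trans (s-bound i)
          (ℕₚ.<-≤-trans (ℕₚ.m<m+n p 1≤g) (ℕₚ.m≤m+n (p + g) (d * p))))
      where
      s≡ : s i ≡ p + g + d * p
      s≡ = ℕₚ.+-cancelʳ-≡ (v * p) (s i) (p + g + d * p) (trans (sym eq) (larger g v d p))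

  m/2≡p : m / 2 ≡ p
  m/2≡p = trans (cong (_/ 2) m≡p*2) (m*n/n≡m p 2)

  -- The stretch from one forbidden half-height to the next. `carry` is 1 when the stretch wraps
  -- into the next period and 0 otherwise; `end≤` keeps it inside the window where `free-at`
  -- applies.
  record Gap (j : ℕ) : Set where
    field
      nonempty : 0 < secLen m k s j
      carry    : ℕ
      end      : s (j mod suc k) + secLen m k s j ≡ s (suc j mod suc k) + carry * p
      end≤     : s (j mod suc k) + secLen m k s j ≤ p + s zero
      avoids   : ∀ i g → s (j mod suc k) < g → g < s (j mod suc k) + secLen m k s j → s i ≢ g

  gap : ∀ j → Gap j
  gap j with mod-suc k j
  ... | inj₁ (r<k , r′≡1+r) = record
    { nonempty = subst (0 <_) (sym len) (ℕₚ.m<n⇒0<n∸m s-step)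
    ; carry    = 0
    ; end      = trans end′ (sym (ℕₚ.+-identityʳ (s i′)))
    ; end≤     = ℕₚ.≤-trans (ℕₚ.≤-reflexive end′) (ℕₚ.≤-trans (s-bound i′) (ℕₚ.m≤m+n p (s zero)))
    ; avoids   = λ x g i<g g<end sx≡g → separate x (subst (s i <_) (sym sx≡g) i<g)
                   (subst₂ _<_ (sym sx≡g) end′ g<end)
    }
    where
    i i′ : Fin (suc k)
    i = j mod suc k
    i′ = suc j mod suc k
    s-step : s i < s i′
    s-step = s-mono i i′ (ℕₚ.≤-reflexive (sym r′≡1+r))
    len : secLen m k s j ≡ s i′ ∸ s i
    len rewrite Equivalence.to Boolₚ.T-≡ (ℕₚ.≤⇒≤ᵇ r<k) =
      cong (_∸ s i) (trans (cong (sAt k s) (sym r′≡1+r)) (sAt-toℕ k s i′))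
    end′ : s i + secLen m k s j ≡ s i′
    end′ = trans (cong (λ n → s i + n) len) (ℕₚ.m+[n∸m]≡n (ℕₚ.<⇒≤ s-step))
    separate : ∀ x → s i < s x → s x < s i′ → ⊥
    separate x i<x x<i′ with ℕₚ.<-≤-connex (toℕ i) (toℕ x)
    -- No index lies strictly between two consecutive ones, so monotonicity leaves no value of `s`
    -- strictly between theirs.
    ... | inj₁ r<x = ℕₚ.<⇒≱ x<i′ (s-mono-≤ i′ x (subst (_≤ toℕ x) (sym r′≡1+r) r<x))
    ... | inj₂ x≤r = ℕₚ.<⇒≱ i<x (s-mono-≤ x i x≤r)
  ... | inj₂ (r≡k , i′≡0) = record
    { nonempty = subst (0 <_) (sym len) (ℕₚ.≤-trans (s-pos zero) (ℕₚ.m≤n+m (s zero) (p ∸ s i)))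
    ; carry    = 1
    ; end      = trans end′ (trans (ℕₚ.+-comm p (s zero))
                   (cong₂ _+_ (cong s (sym i′≡0)) (sym (ℕₚ.+-identityʳ p))))
    ; end≤     = ℕₚ.≤-reflexive end′
    ; avoids   = λ x g i<g _ sx≡g → ℕₚ.<⇒≱ i<g (subst (_≤ s i) sx≡g
                   (s-mono-≤ x i (subst (toℕ x ≤_) (sym r≡k) (Finₚ.toℕ≤pred[n] x))))
    }
    where
    i : Fin (suc k)
    i = j mod suc k
    1+r≰k : (suc (toℕ i) ≤ᵇ k) ≡ false
    1+r≰k = Boolₚ.¬-not λ eq → ℕₚ.<⇒≢ (ℕₚ.≤ᵇ⇒≤ _ k (Equivalence.from Boolₚ.T-≡ eq)) r≡k
    len : secLen m k s j ≡ p ∸ s i + s zero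
    len rewrite 1+r≰k = cong (λ n → n ∸ s i + s zero) m/2≡p
    end′ : s i + secLen m k s j ≡ p + s zero
    end′ = trans (cong (λ n → s i + n) len) (trans (sym (ℕₚ.+-assoc (s i) (p ∸ s i) (s zero)))
             (cong (_+ s zero) (ℕₚ.m+[n∸m]≡n (s-bound i))))

  -- The index of the last determinant before the section; its double is the forbidden height at
  -- which the progression turns.
  sectionStart : ℕ → ℕ
  sectionStart j = s zero + secOffset m k s j

  sectionStart-suc : ∀ j → sectionStart (suc j) ≡ sectionStart j + secLen m k s j
  sectionStart-suc j = sym (ℕₚ.+-assoc (s zero) (secOffset m k s j) (secLen m k s j))

  sectionStart-residue : ∀ j → ∃ λ q → sectionStart j ≡ s (j mod suc k) + q * p
  sectionStart-residue zero    = 0 , refl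
  sectionStart-residue (suc j) = let (q , eq) = sectionStart-residue j in carry + q , (begin
    sectionStart (suc j)                                  ≡⟨ sectionStart-suc j ⟩
    sectionStart j + secLen m k s j                       ≡⟨ cong (_+ secLen m k s j) eq ⟩
    s (j mod suc k) + q * p + secLen m k s j              ≡⟨ swap (s (j mod suc k)) (q * p) (secLen m k s j) ⟩
    s (j mod suc k) + secLen m k s j + q * p              ≡⟨ cong (_+ q * p) end ⟩
    s (suc j mod suc k) + carry * p + q * p               ≡⟨ collect (s (suc j mod suc k)) carry q p ⟩
    s (suc j mod suc k) + (carry + q) * p                 ∎)
    where
    open Gap (gap j)
    open ≡-Reasoning
    swap : ∀ x y z → x + y + z ≡ x + z + y
    swap = solve-∀ℕ
    collect : ∀ x c q p → x + c * p + q * p ≡ x + (c + q) * p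
    collect = solve-∀ℕ

  open Paths bad using (weight; paths-moment)

  D : ℕ → ℤ
  D = continuant weight

  hankelD≡D : ∀ n → hankelD m (Vof k s) n ≡ D n
  hankelD≡D n = trans
    (det-cong n (λ i j → + dMV m (Vof k s) (toℕ i + toℕ j)) (λ i j → moment weight (toℕ i + toℕ j))
      (λ i j → paths-moment odd-free (toℕ i + toℕ j)))
    (hankel-moment weight n)

  open Recurrence (λ g → bad (g * 2)) D (continuant-last weight)

  bad-sectionStart : ∀ j → bad (sectionStart j * 2) ≡ true
  bad-sectionStart j = let (q , eq) = sectionStart-residue j in
    trans (cong (λ n → bad (n * 2)) eq) (bad-at (j mod suc k) q)

  -- Subtracting the `q` full periods contained in the section start moves `g` into the gap between
  -- two forbidden half-heights.
  free-section : ∀ j → Free (sectionStart j) (secLen m k s j)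
  free-section j g b<g g<end with sectionStart-residue j
  ... | q , eq = trans (cong (λ n → bad (n * 2)) (sym g≡))
      (free-at r q (ℕₚ.≤-trans (s-pos (j mod suc k)) (ℕₚ.<⇒≤ i<r)) (ℕₚ.<-≤-trans r<end end≤)
        (λ i → avoids i r i<r r<end))
    where
    open Gap (gap j)
    i = j mod suc k
    r = g ∸ q * p
    g≡ : r + q * p ≡ g
    g≡ = ℕₚ.m∸n+n≡m (ℕₚ.≤-trans (ℕₚ.m≤n+m (q * p) (s i)) (ℕₚ.≤-trans (ℕₚ.≤-reflexive (sym eq)) (ℕₚ.<⇒≤ b<g)))
    i<r : s i < r
    i<r = ℕₚ.+-cancelʳ-< (q * p) (s i) r (subst₂ _<_ eq (sym g≡) b<g)
    swap : ∀ x y z → x + y + z ≡ x + z + y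
    swap = solve-∀ℕ
    r<end : r < s i + secLen m k s j
    r<end = ℕₚ.+-cancelʳ-< (q * p) r (s i + secLen m k s j)
      (subst₂ _<_ (sym g≡) (trans (cong (_+ secLen m k s j) eq) (swap (s i) (q * p) (secLen m k s j))) g<end)

  -- The initial ones form a progression of difference 0, with the empty determinant as its backward
  -- extension. Thus the first section also arises from a turn.
  initial-start : StartsProgression 0 (+ 1) (+ 0)
  initial-start = refl , refl

  initial-free : Free 0 (s zero)
  initial-free g 0<g g<s₀ = trans (cong (λ n → bad (n * 2)) (sym (ℕₚ.+-identityʳ g)))
    (free-at g 0 0<g (ℕₚ.<-≤-trans g<s₀ (ℕₚ.m≤n+m (s zero) p))
      (λ i s≡g → ℕₚ.<⇒≱ g<s₀ (subst (s zero ≤_) s≡g (s-mono-≤ zero i z≤n))))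

  section-start : ∀ j → let open AD (secAD m k s j) in StartsProgression (sectionStart j) first diff
  section-start zero    = subst (λ b → StartsProgression b (+ 0) (- (+ 1))) (sym (ℕₚ.+-identityʳ (s zero)))
    -- Turning from the constant progression 1 gives first term 0, the old difference, and new
    -- difference 0 - 1.
    (subst (StartsProgression (s zero) (+ 0)) (slope (+ (s zero ∸ 1)))
      (turn (s zero) (s-pos zero) initial-start initial-free
        (subst (λ n → bad (n * 2) ≡ true) (ℕₚ.+-identityʳ (s zero)) (bad-sectionStart 0))))
    where
    slope : ∀ x → + 0 - (+ 1 +ℤ x *ℤ + 0) ≡ - (+ 1)
    slope = solve-∀
  section-start (suc j) = subst (λ b → StartsProgression b diff (diff - (first +ℤ + (secLen m k s j ∸ 1) *ℤ diff)))
    (sym (sectionStart-suc j))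
    (turn (secLen m k s j) (Gap.nonempty (gap j)) (section-start j) (free-section j)
      (subst (λ n → bad (n * 2) ≡ true) (sectionStart-suc j) (bad-sectionStart (suc j))))
    where open AD (secAD m k s j)

  hankelD-initial : ∀ n → 1 ≤ n → n ≤ s zero → hankelD m (Vof k s) n ≡ + 1
  hankelD-initial (suc i) _ i<s₀ = trans (hankelD≡D (suc i))
    (trans (proj₂ (progression initial-start initial-free i i<s₀)) (cong (λ z → + 1 +ℤ z) (ℤₚ.*-zeroʳ (+ i))))

  hankelD-section : ∀ j i → i < secLen m k s j →
    hankelD m (Vof k s) (s zero + secOffset m k s j + suc i)
      ≡ AD.first (secAD m k s j) +ℤ + i *ℤ AD.diff (secAD m k s j)
  hankelD-section j i i<len = trans (hankelD≡D (sectionStart j + suc i))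
    (trans (cong D (ℕₚ.+-suc (sectionStart j) i))
           (proj₂ (progression (section-start j) (free-section j) i i<len)))

theorem1p1 : (m : ℕ) .{{_ : NonZero m}} (k : ℕ) (s : Fin (suc k) → ℕ) →
    2 ≤ m → 2 ∣ m →
    (∀ i → 1 ≤ s i) →
    (∀ i j → i <ᶠ j → s i < s j) →
    (∀ i → 2 * s i ≤ m) →
    ((n : ℕ) → 1 ≤ n → n ≤ s zero → hankelD m (Vof k s) n ≡ + 1)
    ×
    ((j i : ℕ) → i < secLen m k s j →
    hankelD m (Vof k s) (s zero + secOffset m k s j + suc i)
    ≡ AD.first (secAD m k s j) +ℤ ((+ i) *ℤ AD.diff (secAD m k s j)))
-- Divisibility by 2 supplies `p` as half of `m`.
theorem1p1 m k s _ (divides p m≡p*2) s-pos s-mono 2s≤m = hankelD-initial , hankelD-section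
  where
  open Sections m k s p m≡p*2 s-pos s-mono
    (λ i → ℕₚ.*-cancelˡ-≤ 2 (subst (2 * s i ≤_) (trans m≡p*2 (ℕₚ.*-comm p 2)) (2s≤m i)))
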